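{- Let $D$ be an oriented graph on $n$ vertices. If $a(D)+\sum_{v\in V(D)}\omega^+(v)\geq n(n+1)/2$, then $D$ contains a directed triangle.
   Context: All graphs are simple and finite, with at least one vertex. An oriented graph is a digraph obtained from a simple undirected graph by replacing each edge with exactly one of the two possible arcs with the same ends. $a(D)$ denotes the number of arcs of $D$. For a vertex $v$ of $D$, $N^+(v)$ is the set of out-neighbors of $v$, $D[N^+(v)]$ is the subdigraph of $D$ induced by $N^+(v)$, and the out-component number $\omega^+(v)$ is the number of components of $D[N^+(v)]$, where components are the connected components of the underlying undirected graph (so $\omega^+(v)=0$ if $N^+(v)=\emptyset$). A directed triangle is a directed cycle of length 3. -}

module Defs where

open import Data.Fin using (Fin; zero; suc; punchIn; punchOut)
open import Data.Fin.Properties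
  using (_≟_; punchOut-cong; punchOut-injective; punchOut-punchIn; punchInᵢ≢i; injective⇒≤)
open import Data.Fin.Subset using (Subset; inside; outside; _∈_)
open import Data.List using (List; []; _∷_; length; filter; map; allFin; cartesianProduct)
import Data.List.Membership.Propositional as List
open import Data.List.Membership.Propositional.Properties
  using (∈-filter⁺; ∈-filter⁻; ∈-cartesianProduct⁺; ∈-allFin; ∈-map⁺)
open import Data.List.Relation.Unary.Any using (here; there)
open import Data.Nat using (ℕ; zero; suc; _≤_)
open import Data.Nat.Properties using (≤-antisym)
open import Data.Product using (_×_; _,_; proj₁; proj₂; ∃; ∃-syntax; uncurry)
open import Data.Sum using (_⊎_; inj₁; inj₂)
open import Data.Vec using (_∷_; []; tabulate; here; there)
open import Function using (_∘_; _on_; _⇔_; mk⇔; Equivalence; _↔_; mk↔ₛ′; Inverse)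
open import Function.Definitions using (StrictlySurjective)
open import Level using (0ℓ)
open import Relation.Binary using (Rel; Decidable; Asymmetric; IsEquivalence)
open import Relation.Binary.Construct.Closure.Equivalence as EqC using (EqClosure)
import Relation.Binary.Construct.On as On
open import Relation.Binary.PropositionalEquality
  using (_≡_; _≢_; refl; sym; trans; cong; isEquivalence)
open import Relation.Nullary using (yes; no; does; contradiction)

-- Asymmetry says that at most one of u ⟶ v and v ⟶ u holds; it also excludes
-- loops.
record OrientedGraph (V : Set) : Set₁ where
  infix 4 _⟶_ _⟶?_

  field
    _⟶_  : Rel V 0ℓ
    _⟶?_ : Decidable _⟶_
    asym : Asymmetric _⟶_

  -- Joined by a path in the underlying undirected graph.
  Connected : Rel V 0ℓ
  Connected = EqClosure _⟶_

  -- The three vertices are automatically distinct, by asymmetry.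
  HasDirectedTriangle : Set
  HasDirectedTriangle = ∃[ u ] ∃[ v ] ∃[ w ] (u ⟶ v × v ⟶ w × w ⟶ u)

open OrientedGraph using (Connected; HasDirectedTriangle) public

-- The classes of the equivalence relation _≈_ are exactly k in number: they
-- are the fibres of a surjection onto Fin k.
record HasClasses {V : Set} (_≈_ : Rel V 0ℓ) (k : ℕ) : Set where
  field
    class      : V → Fin k
    surjective : StrictlySurjective _≡_ class
    same⇔≈     : ∀ {u v} → class u ≡ class v ⇔ u ≈ v

HasComponents : {V : Set} → OrientedGraph V → ℕ → Set
HasComponents G = HasClasses (Connected G)

module _ {n : ℕ} (D : OrientedGraph (Fin n)) where
  open OrientedGraph D

  arcs : List (Fin n × Fin n)
  arcs = filter (uncurry _⟶?_) (cartesianProduct (allFin n) (allFin n))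

  a : ℕ
  a = length arcs

  N⁺ : Fin n → Subset n
  N⁺ v = tabulate λ u → does (v ⟶? u)

  -- Membership in a Subset is proof-irrelevant, so every element of S occurs
  -- exactly once as a vertex of the induced subdigraph.
  _[_] : (S : Subset n) → OrientedGraph (∃ (_∈ S))
  _[_] S = record
    { _⟶_  = _⟶_ on proj₁
    ; _⟶?_ = λ u v → proj₁ u ⟶? proj₁ v
    ; asym = asym
    }

private
  classes-≤ : {V : Set} {_≈_ : Rel V 0ℓ} {k l : ℕ} →
              HasClasses _≈_ k → HasClasses _≈_ l → k ≤ l
  classes-≤ P Q = injective⇒≤ {f = Q.class ∘ proj₁ ∘ P.surjective} λ {i} {j} eq →
    trans (sym (proj₂ (P.surjective i)))
      (trans (Equivalence.from P.same⇔≈ (Equivalence.to Q.same⇔≈ eq))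
             (proj₂ (P.surjective j)))
    where
    module P = HasClasses P
    module Q = HasClasses Q

hasClasses-unique : {V : Set} {_≈_ : Rel V 0ℓ} {k l : ℕ} →
                    HasClasses _≈_ k → HasClasses _≈_ l → k ≡ l
hasClasses-unique P Q = ≤-antisym (classes-≤ P Q) (classes-≤ Q P)

private
  -- Identify i with j.
  module Merge {k : ℕ} (i j : Fin (suc k)) (j≢i : j ≢ i) where

    merge : Fin (suc k) → Fin k
    merge x with j ≟ x
    ... | yes _   = punchOut j≢i
    ... | no  j≢x = punchOut j≢x

    merge-surjective : StrictlySurjective _≡_ merge
    merge-surjective y = punchIn j y , eq
      where
      eq : merge (punchIn j y) ≡ y
      eq with j ≟ punchIn j y
      ... | yes p = contradiction (sym p) (punchInᵢ≢i j y)
      ... | no  _ = trans (punchOut-cong j refl) (punchOut-punchIn j)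

    merge-ij : merge i ≡ merge j
    merge-ij with j ≟ i | j ≟ j
    ... | yes p | _     = contradiction p j≢i
    ... | no  _ | yes _ = punchOut-cong j refl
    ... | no  _ | no ¬p = contradiction refl ¬p

    merge-≡ : ∀ x y → merge x ≡ merge y →
              x ≡ y ⊎ (x ≡ i × y ≡ j) ⊎ (x ≡ j × y ≡ i)
    merge-≡ x y eq with j ≟ x | j ≟ y
    ... | yes p | yes q = inj₁ (trans (sym p) q)
    ... | yes p | no  q = inj₂ (inj₂ (sym p , sym (punchOut-injective j≢i q eq)))
    ... | no  p | yes q = inj₂ (inj₁ (punchOut-injective p j≢i eq , sym q))
    ... | no  p | no  q = inj₁ (punchOut-injective p q eq)

  Listed : {V : Set} → List (V × V) → Rel V 0ℓ
  Listed L u v = (u , v) List.∈ L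

  module _ {V : Set} (x y : V) (L : List (V × V)) where

    private
      weaken : ∀ {u v} → EqClosure (Listed L) u v → EqClosure (Listed ((x , y) ∷ L)) u v
      weaken = EqC.map there

      fibres : ∀ {k} (f : V → Fin k) → IsEquivalence (_≡_ on f)
      fibres f = On.isEquivalence f isEquivalence

    addEdge : ∀ {k} → HasClasses (EqClosure (Listed L)) k →
              ∃ (HasClasses (EqClosure (Listed ((x , y) ∷ L))))
    addEdge {k} P with HasClasses.class P y ≟ HasClasses.class P x
    ... | yes same = k , record
      { class      = P.class
      ; surjective = P.surjective
      ; same⇔≈     = mk⇔ (weaken ∘ Equivalence.to P.same⇔≈)
                         (EqC.fold (fibres P.class) λ
                           { (here refl) → sym same
                           ; (there e)   → Equivalence.from P.same⇔≈ (EqC.return e) })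
      }
      where module P = HasClasses P
    addEdge {zero}  P | no _ with HasClasses.class P x
    ... | ()
    addEdge {suc k} P | no y≢x = k , record
      { class      = merge ∘ P.class
      ; surjective = surj
      ; same⇔≈     = mk⇔ to
                         (EqC.fold (fibres (merge ∘ P.class)) λ
                           { (here refl) → merge-ij
                           ; (there e)   → cong merge (Equivalence.from P.same⇔≈ (EqC.return e)) })
      }
      where
      module P = HasClasses P
      open Merge (P.class x) (P.class y) y≢x

      surj : StrictlySurjective _≡_ (merge ∘ P.class)
      surj z = let (w , w↦z) = merge-surjective z
                   (v , v↦w) = P.surjective w
               in v , trans (cong merge v↦w) w↦z

      new : EqClosure (Listed ((x , y) ∷ L)) x y
      new = EqC.return (here refl)

      old : ∀ {u v} → P.class u ≡ P.class v → EqClosure (Listed ((x , y) ∷ L)) u v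
      old = weaken ∘ Equivalence.to P.same⇔≈

      to : ∀ {u v} → merge (P.class u) ≡ merge (P.class v) →
           EqClosure (Listed ((x , y) ∷ L)) u v
      to eq with merge-≡ _ _ eq
      ... | inj₁ p              = old p
      ... | inj₂ (inj₁ (p , q)) =
        EqC.transitive _ (old p) (EqC.transitive _ new (old (sym q)))
      ... | inj₂ (inj₂ (p , q)) =
        EqC.transitive _ (old p) (EqC.transitive _ (EqC.symmetric _ new) (old (sym q)))

  listed-classes : {V : Set} {m : ℕ} → V ↔ Fin m → (L : List (V × V)) →
                   ∃ (HasClasses (EqClosure (Listed L)))
  listed-classes {m = m} V↔m [] = m , record
    { class      = to
    ; surjective = λ i → from i , strictlyInverseˡ i
    ; same⇔≈     = mk⇔ injective
                       (EqC.fold (On.isEquivalence to isEquivalence) λ ())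
    }
    where
    open Inverse V↔m
    injective : ∀ {u v} → to u ≡ to v → EqClosure (Listed []) u v
    injective {u} {v} eq
      with refl ← trans (sym (strictlyInverseʳ u)) (trans (cong from eq) (strictlyInverseʳ v))
      = EqC.reflexive _
  listed-classes V↔m ((x , y) ∷ L) = addEdge x y L (proj₂ (listed-classes V↔m L))

components : {V : Set} {m : ℕ} → V ↔ Fin m → (G : OrientedGraph V) → ∃ (HasComponents G)
components {V} {m} V↔m G = k , record
  { class      = class
  ; surjective = surjective
  ; same⇔≈     = mk⇔ (EqC.map (proj₂ ∘ ∈-filter⁻ (uncurry _⟶?_) {xs = pairs})
                        ∘ Equivalence.to same⇔≈)
                     (Equivalence.from same⇔≈
                        ∘ EqC.map (∈-filter⁺ (uncurry _⟶?_) (∈-cartesianProduct⁺ (all _) (all _))))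
  }
  where
  open OrientedGraph G
  open Inverse V↔m using (from; strictlyInverseʳ)

  vertices : List V
  vertices = map from (allFin m)

  all : ∀ v → v List.∈ vertices
  all v with ∈-map⁺ from (∈-allFin (Inverse.to V↔m v))
  ... | p rewrite strictlyInverseʳ v = p

  pairs : List (V × V)
  pairs = cartesianProduct vertices vertices

  result : ∃ (HasClasses (EqClosure (Listed (filter (uncurry _⟶?_) pairs))))
  result = listed-classes V↔m (filter (uncurry _⟶?_) pairs)

  k = proj₁ result
  open HasClasses (proj₂ result)

enumerate : ∀ {n} (S : Subset n) → ∃[ m ] (∃ (_∈ S) ↔ Fin m)
enumerate [] = 0 , mk↔ₛ′ (λ ()) (λ ()) (λ ()) (λ ())
enumerate (outside ∷ S) with enumerate S
... | m , e = m , mk↔ₛ′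
  (λ { (suc i , there p) → to (i , p) })
  (λ j → let (i , p) = from j in suc i , there p)
  strictlyInverseˡ
  (λ { (suc i , there p) → cong (λ (i , p) → suc i , there p) (strictlyInverseʳ (i , p)) })
  where open Inverse e
enumerate (inside ∷ S) with enumerate S
... | m , e = suc m , mk↔ₛ′
  (λ { (zero , here) → zero ; (suc i , there p) → suc (to (i , p)) })
  (λ { zero → zero , here ; (suc j) → let (i , p) = from j in suc i , there p })
  (λ { zero → refl ; (suc j) → cong suc (strictlyInverseˡ j) })
  (λ { (zero , here) → refl
     ; (suc i , there p) → cong (λ (i , p) → suc i , there p) (strictlyInverseʳ (i , p)) })
  where open Inverse e

module _ {n : ℕ} (D : OrientedGraph (Fin n)) where

  hasComponents : (S : Subset n) → ∃ (HasComponents (D [ S ]))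
  hasComponents S = components (proj₂ (enumerate S)) (D [ S ])

  ω⁺ : Fin n → ℕ
  ω⁺ v = proj₁ (hasComponents (N⁺ D v))

{-# OPTIONS --safe #-}
-- Assume there is no directed triangle and induct on n, deleting a vertex v with
-- the largest number of non-neighbours.  Deleting v lowers ω⁺(u) only if v is an
-- isolated vertex of D[N⁺(u)], and then by at most one.  The vertices u for which this
-- happens, together with one representative of every component of D[N⁺(v)], form
-- an independent set C: an arc inside C would join two components of D[N⁺(v)], give
-- v a neighbour in N⁺(u), or close a directed triangle.  All of C lies among the non-neighbours of any of its
-- members, so by the choice of v it has at most n − deg(v) elements (counting a
-- vertex as its own non-neighbour).  Hence a(D) + Σ ω⁺ drops by at most n.
module Submission where

open import Defs
open import Data.Fin using (Fin; zero; suc; punchIn; punchOut)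
open import Data.Fin.Properties
  using (_≟_; any?; suc-injective; injective⇒≤; punchIn-punchOut)
open import Data.Fin.Subset using (Subset; _∈_)
open import Data.List using (length; filter; map; tabulate; allFin; cartesianProduct; _++_)
open import Data.List.Extrema.Nat using (argmax; f[xs]≤f[argmax])
open import Data.List.Membership.Propositional.Properties using (∈-allFin)
open import Data.List.Properties using (filter-++; length-++; map-tabulate)
import Data.List.Relation.Unary.All as All
open import Data.Bool using (true; false; if_then_else_)
open import Data.Nat
  using (ℕ; zero; suc; NonZero; _+_; _*_; _/_; _≤_; _<_; _≥_; z≤n; s≤s)
open import Data.Nat.DivMod using (+-distrib-/-∣ʳ; m*n/n≡m)
open import Data.Nat.Divisibility using (n∣m*n)
open import Data.Nat.Properties
  using (+-0-commutativeMonoid; ≤-refl; ≤-trans; ≤-reflexive; +-assoc; +-mono-≤;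
         +-monoˡ-≤; +-monoʳ-≤; m≤n+m; <⇒≱; module ≤-Reasoning)
open import Data.Nat.Tactic.RingSolver using (solve-∀)
open import Data.Product using (_×_; _,_; proj₁; proj₂; ∃; uncurry)
open import Data.Sum using (_⊎_; inj₁; inj₂; [_,_]; swap)
open import Data.Vec.Properties using (lookup∘tabulate; []=⇒lookup; lookup⇒[]=)
open import Data.Vec.Properties.WithK using ([]=-irrelevant)
open import Function using (_∘_; id; const; _on_; Injective; Equivalence)
open import Relation.Binary using (Rel)
import Relation.Binary.Construct.Closure.Equivalence as EqC
open import Relation.Binary.PropositionalEquality
  using (_≡_; refl; sym; trans; cong; cong₂; subst; module ≡-Reasoning)
open import Relation.Nullary using (Dec; yes; no; does; ¬_; contradiction)
open import Relation.Nullary.Decidable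
  using (_×-dec_; _⊎-dec_; ¬?; decidable-stable; dec-true)
open import Relation.Unary using (Pred; Decidable)
open import Level using (0ℓ)
open import Algebra.Properties.CommutativeMonoid.Sum +-0-commutativeMonoid
  using (sum; sum-syntax; sum-remove; sum-cong-≗; ∑-distrib-+)

-- Indicators, sums and counting over `Fin n`.

⟦_⟧ : {P : Set} → Dec P → ℕ
⟦ p? ⟧ = if does p? then 1 else 0

⟦⟧-no : {P : Set} (p? : Dec P) → ¬ P → ⟦ p? ⟧ ≡ 0
⟦⟧-no (yes p) ¬p = contradiction p ¬p
⟦⟧-no (no _)  ¬p = refl

⟦⟧-mono : {P Q : Set} (p? : Dec P) (q? : Dec Q) → (P → Q) → ⟦ p? ⟧ ≤ ⟦ q? ⟧
⟦⟧-mono (no _)  _       _   = z≤n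
⟦⟧-mono (yes _) (yes _) _   = ≤-refl
⟦⟧-mono (yes p) (no ¬q) p⇒q = contradiction (p⇒q p) ¬q

⟦⟧-⊎ : {P Q : Set} (p? : Dec P) (q? : Dec Q) → ¬ (P × Q) →
       ⟦ p? ⟧ + ⟦ q? ⟧ ≤ ⟦ p? ⊎-dec q? ⟧
⟦⟧-⊎ (yes p) (yes q) disjoint = contradiction (p , q) disjoint
⟦⟧-⊎ (yes _) (no _)  _        = ≤-refl
⟦⟧-⊎ (no _)  (yes _) _        = ≤-refl
⟦⟧-⊎ (no _)  (no _)  _        = ≤-refl

-- Packages two bounds for the loss of components when a vertex is deleted: the weak one holds
-- always, the sharp one when the vertex is not isolated.
≤⟦⟧+ : {P : Set} (p? : Dec P) {k l : ℕ} → (¬ P → k ≤ l) → k ≤ suc l → k ≤ ⟦ p? ⟧ + l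
≤⟦⟧+ (yes _) _      k≤1+l = k≤1+l
≤⟦⟧+ (no ¬p) ¬p⇒k≤l _     = ¬p⇒k≤l ¬p

⟦⟧-¬ : {P : Set} (p? : Dec P) → ⟦ p? ⟧ + ⟦ ¬? p? ⟧ ≡ 1
⟦⟧-¬ (yes _) = refl
⟦⟧-¬ (no _)  = refl

sum-mono : ∀ {n} {f g : Fin n → ℕ} → (∀ i → f i ≤ g i) → sum f ≤ sum g
sum-mono {zero}  f≤g = z≤n
sum-mono {suc n} f≤g = +-mono-≤ (f≤g zero) (sum-mono (f≤g ∘ suc))

sum-punchIn-≤ : ∀ {n} v (f : Fin (suc n) → ℕ) → sum (f ∘ punchIn v) ≤ sum f
sum-punchIn-≤ v f = ≤-trans (m≤n+m _ (f v)) (≤-reflexive (sym (sum-remove {i = v} f)))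

sum-1 : ∀ n → ∑[ i < n ] 1 ≡ n
sum-1 zero    = refl
sum-1 (suc n) = cong suc (sum-1 n)

count : ∀ {n} {P : Pred (Fin n) 0ℓ} → Decidable P → ℕ
count P? = sum λ i → ⟦ P? i ⟧

module _ {n : ℕ} {P Q : Pred (Fin n) 0ℓ} (P? : Decidable P) (Q? : Decidable Q) where

  count-mono : (∀ {i} → P i → Q i) → count P? ≤ count Q?
  count-mono P⇒Q = sum-mono λ i → ⟦⟧-mono (P? i) (Q? i) P⇒Q

  count-⊎ : (∀ {i} → ¬ (P i × Q i)) →
            count P? + count Q? ≤ count (λ i → P? i ⊎-dec Q? i)
  count-⊎ disjoint = ≤-trans
    (≤-reflexive (sym (∑-distrib-+ (λ i → ⟦ P? i ⟧) (λ i → ⟦ Q? i ⟧))))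
    (sum-mono λ i → ⟦⟧-⊎ (P? i) (Q? i) disjoint)

count-¬ : ∀ {n} {P : Pred (Fin n) 0ℓ} (P? : Decidable P) →
          count P? + count (¬? ∘ P?) ≡ n
count-¬ {n} P? = begin
  count P? + count (¬? ∘ P?)              ≡⟨ ∑-distrib-+ (λ i → ⟦ P? i ⟧) (λ i → ⟦ ¬? (P? i) ⟧) ⟨
  ∑[ i < n ] (⟦ P? i ⟧ + ⟦ ¬? (P? i) ⟧)   ≡⟨ sum-cong-≗ (λ i → ⟦⟧-¬ (P? i)) ⟩
  ∑[ i < n ] 1                            ≡⟨ sum-1 n ⟩
  n                                       ∎
  where open ≡-Reasoning

-- The position of `i` among the elements of `P`. It turns an injection into `P` into one into
-- `Fin (count P?)`, where the pigeonhole principle applies.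
rank : ∀ {n} {P : Pred (Fin n) 0ℓ} (P? : Decidable P) {i : Fin n} → P i → Fin (count P?)
rank P? {zero} p with P? zero
... | yes _ = zero
... | no ¬p = contradiction p ¬p
rank P? {suc i} p with P? zero
... | yes _ = suc (rank (P? ∘ suc) p)
... | no _  = rank (P? ∘ suc) p

rank-injective : ∀ {n} {P : Pred (Fin n) 0ℓ} (P? : Decidable P) {i j : Fin n}
                 (p : P i) (q : P j) → rank P? p ≡ rank P? q → i ≡ j
rank-injective P? {zero}  {zero}  p q eq = refl
rank-injective P? {zero}  {suc j} p q eq with P? zero
rank-injective P? {zero}  {suc j} p q () | yes _
... | no ¬p = contradiction p ¬p
rank-injective P? {suc i} {zero}  p q eq with P? zero
rank-injective P? {suc i} {zero}  p q () | yes _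
... | no ¬q = contradiction q ¬q
rank-injective P? {suc i} {suc j} p q eq with P? zero
... | yes _ = cong suc (rank-injective (P? ∘ suc) p q (suc-injective eq))
... | no _  = cong suc (rank-injective (P? ∘ suc) p q eq)

injection⇒≤count : ∀ {n k} {P : Pred (Fin n) 0ℓ} (P? : Decidable P) (f : Fin k → Fin n) →
                   Injective _≡_ _≡_ f → (∀ i → P (f i)) → k ≤ count P?
injection⇒≤count P? f f-injective Pf =
  injective⇒≤ {f = λ i → rank P? (Pf i)} (f-injective ∘ rank-injective P? (Pf _) (Pf _))

length-filter-tabulate : {A : Set} {P : Pred A 0ℓ} (P? : Decidable P) → ∀ {n} (f : Fin n → A) →
                         length (filter P? (tabulate f)) ≡ count (P? ∘ f)
length-filter-tabulate P? {zero}  f = refl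
length-filter-tabulate P? {suc n} f with does (P? (f zero))
... | true  = cong suc (length-filter-tabulate P? (f ∘ suc))
... | false = length-filter-tabulate P? (f ∘ suc)

-- Serves to write `a D` as a double sum, from which the row and the column of one vertex can be
-- split off.
length-filter-cartesianProduct :
  {A B : Set} {P : Pred (A × B) 0ℓ} (P? : Decidable P) →
  ∀ {m n} (f : Fin m → A) (g : Fin n → B) →
  length (filter P? (cartesianProduct (tabulate f) (tabulate g))) ≡
  ∑[ i < m ] count (λ j → P? (f i , g j))
length-filter-cartesianProduct P? {zero}  f g = refl
length-filter-cartesianProduct P? {suc m} f g = begin
  length (filter P? (row ++ rest))                     ≡⟨ cong length (filter-++ P? row rest) ⟩
  length (filter P? row ++ filter P? rest)             ≡⟨ length-++ (filter P? row) ⟩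
  length (filter P? row) + length (filter P? rest)     ≡⟨ cong₂ _+_ row-count (length-filter-cartesianProduct P? (f ∘ suc) g) ⟩
  (∑[ i < suc m ] count (λ j → P? (f i , g j)))        ∎
  where
  open ≡-Reasoning
  row  = map (f zero ,_) (tabulate g)
  rest = cartesianProduct (tabulate (f ∘ suc)) (tabulate g)

  row-count : length (filter P? row) ≡ count (λ j → P? (f zero , g j))
  row-count = trans (cong (length ∘ filter P?) (map-tabulate g (f zero ,_)))
                    (length-filter-tabulate P? ((f zero ,_) ∘ g))

-- Components of out-neighbourhoods and the independent set `C`.

classes≤ : ∀ {V : Set} {_≈_ : Rel V 0ℓ} {k l} → HasClasses _≈_ k →
           (c : V → Fin l) → (∀ {x y} → c x ≡ c y → x ≈ y) → k ≤ l
-- Pick one element of each class: since `c` never identifies elements of different classes, it is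
-- injective on these.
classes≤ P c c⇒≈ = injective⇒≤ {f = c ∘ proj₁ ∘ surjective} λ {i} {j} eq →
  trans (sym (proj₂ (surjective i)))
    (trans (Equivalence.from same⇔≈ (c⇒≈ eq)) (proj₂ (surjective j)))
  where open HasClasses P

vertex-≡ : ∀ {n} {S : Subset n} {x y : ∃ (_∈ S)} → proj₁ x ≡ proj₁ y → x ≡ y
vertex-≡ {x = x , p} {y = .x , q} refl = cong (x ,_) ([]=-irrelevant p q)

module _ {n : ℕ} (D : OrientedGraph (Fin n)) where
  open OrientedGraph D using (_⟶_; _⟶?_; asym)

  Adj : Rel (Fin n) 0ℓ
  Adj u v = u ⟶ v ⊎ v ⟶ u

  adj? : ∀ u v → Dec (Adj u v)
  adj? u v = (u ⟶? v) ⊎-dec (v ⟶? u)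

  Adj-irrefl : ∀ {u} → ¬ Adj u u
  Adj-irrefl = [ (λ l → asym l l) , (λ l → asym l l) ]

  -- `v` forms a component of `D[N⁺(u)]` by itself, so that deleting `v` destroys a component at
  -- `u`.
  IsolatedIn : Rel (Fin n) 0ℓ
  IsolatedIn u v = u ⟶ v × ¬ (∃ λ w → u ⟶ w × Adj v w)

  linked? : ∀ u v → Dec (∃ λ w → u ⟶ w × Adj v w)
  linked? u v = any? λ w → (u ⟶? w) ×-dec adj? v w

  isolatedIn? : ∀ u v → Dec (IsolatedIn u v)
  isolatedIn? u v = (u ⟶? v) ×-dec ¬? (linked? u v)

  nonAdj# : Fin n → ℕ
  nonAdj# v = count (¬? ∘ adj? v)

  hasDirectedTriangle? : Dec (HasDirectedTriangle D)
  hasDirectedTriangle? =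
    any? λ u → any? λ v → any? λ w → (u ⟶? v) ×-dec ((v ⟶? w) ×-dec (w ⟶? u))

  ⟶⇒∈N⁺ : ∀ {u v} → v ⟶ u → u ∈ N⁺ D v
  ⟶⇒∈N⁺ {u} {v} l = lookup⇒[]= u _ (trans (lookup∘tabulate _ u) (dec-true (v ⟶? u) l))

  ∈N⁺⇒⟶ : ∀ {u v} → u ∈ N⁺ D v → v ⟶ u
  ∈N⁺⇒⟶ {u} {v} p
    with v ⟶? u | trans (sym (lookup∘tabulate (λ w → does (v ⟶? w)) u)) ([]=⇒lookup p)
  ... | yes l | _  = l
  ... | no  _ | ()

  Adj⇒Connected : ∀ {S} {x y : ∃ (_∈ S)} → Adj (proj₁ x) (proj₁ y) → Connected (D [ S ]) x y
  Adj⇒Connected = [ EqC.return , EqC.symmetric _ ∘ EqC.return ]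

  a≡ : a D ≡ ∑[ u < n ] count (u ⟶?_)
  a≡ = length-filter-cartesianProduct (uncurry _⟶?_) id id

  components-N⁺ : ∀ v → HasComponents (D [ N⁺ D v ]) (ω⁺ D v)
  components-N⁺ v = proj₂ (hasComponents D (N⁺ D v))

  module Representatives (v : Fin n) where
    open HasClasses (components-N⁺ v)

    rep : Fin (ω⁺ D v) → Fin n
    rep i = proj₁ (proj₁ (surjective i))

    Rep : Pred (Fin n) 0ℓ
    Rep w = ∃ λ i → rep i ≡ w

    rep? : Decidable Rep
    rep? w = any? λ i → rep i ≟ w

    v⟶rep : ∀ {w} → Rep w → v ⟶ w
    v⟶rep (i , refl) = ∈N⁺⇒⟶ (proj₂ (proj₁ (surjective i)))

    same-class : ∀ {i j} →
                 class (proj₁ (surjective i)) ≡ class (proj₁ (surjective j)) → i ≡ j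
    same-class {i} {j} eq = trans (sym (proj₂ (surjective i))) (trans eq (proj₂ (surjective j)))

    rep-injective : Injective _≡_ _≡_ rep
    rep-injective eq = same-class (cong class (vertex-≡ eq))

    -- Adjacent vertices of `D[N⁺(v)]` share a component, so adjacent representatives would
    -- coincide, and there are no loops.
    reps-independent : ∀ {x y} → Rep x → Rep y → ¬ Adj x y
    reps-independent (i , refl) (j , refl) adj
      with refl ← same-class {i} {j} (Equivalence.from same⇔≈ (Adj⇒Connected adj))
      = Adj-irrefl adj

    ω⁺≤count : ω⁺ D v ≤ count rep?
    ω⁺≤count = injection⇒≤count rep? rep rep-injective λ i → i , refl

  module _ (¬△ : ¬ HasDirectedTriangle D) (v : Fin n) where
    open Representatives v

    C : Pred (Fin n) 0ℓ
    C w = IsolatedIn w v ⊎ Rep w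

    c? : Decidable C
    c? w = isolatedIn? w v ⊎-dec rep? w

    -- Here `x ⟶ v ⟶ y`. An arc from `x` to `y` would give `v` the neighbour `y` inside `N⁺(x)`; the
    -- reverse arc closes a directed triangle.
    isolating-rep-nonadjacent : ∀ {x y} → IsolatedIn x v → Rep y → ¬ Adj x y
    isolating-rep-nonadjacent (_ , ¬l)  r (inj₁ x⟶y) = ¬l (_ , x⟶y , inj₁ (v⟶rep r))
    isolating-rep-nonadjacent (x⟶v , _) r (inj₂ y⟶x) = ¬△ (_ , _ , _ , x⟶v , v⟶rep r , y⟶x)

    C-independent : ∀ {x y} → C x → C y → ¬ Adj x y
    -- Both ends have arcs to `v`, so the head of an arc between them is a neighbour of `v` in the
    -- out-neighbourhood of its tail.
    C-independent (inj₁ (x⟶v , ¬l)) (inj₁ (y⟶v , _)) (inj₁ x⟶y) = ¬l (_ , x⟶y , inj₂ y⟶v)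
    C-independent (inj₁ (x⟶v , _)) (inj₁ (y⟶v , ¬l)) (inj₂ y⟶x) = ¬l (_ , y⟶x , inj₂ x⟶v)
    C-independent (inj₁ i) (inj₂ r) adj = isolating-rep-nonadjacent i r adj
    C-independent (inj₂ r) (inj₁ i) adj = isolating-rep-nonadjacent i r (swap adj)
    C-independent (inj₂ r) (inj₂ s) adj = reps-independent r s adj

    ω⁺+isolations≤nonAdj# : (∀ x → nonAdj# x ≤ nonAdj# v) →
                            ω⁺ D v + count (λ w → isolatedIn? w v) ≤ nonAdj# v
    ω⁺+isolations≤nonAdj# maximal = begin
      ω⁺ D v + count iso?     ≤⟨ +-monoˡ-≤ _ ω⁺≤count ⟩
      -- Representatives are out-neighbours of `v`, isolating vertices are in-neighbours; no vertex
      -- is both.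
      count rep? + count iso? ≤⟨ count-⊎ rep? iso? (λ (r , w⟶v , _) → asym w⟶v (v⟶rep r)) ⟩
      count rep⊎iso?          ≤⟨ count-mono rep⊎iso? c? swap ⟩
      count c?                ≤⟨ C≤ ⟩
      nonAdj# v               ∎
      where
      open ≤-Reasoning
      iso? : Decidable (λ w → IsolatedIn w v)
      iso? w = isolatedIn? w v

      rep⊎iso? : Decidable (λ w → Rep w ⊎ IsolatedIn w v)
      rep⊎iso? w = rep? w ⊎-dec iso? w

      C≤ : count c? ≤ nonAdj# v
      -- All members of `C` are neighbours of `v`, so the size of `C` is first bounded at a member
      -- `x`; maximality carries the bound over to `v`.
      C≤ with any? c?
      ... | yes (x , cx) = ≤-trans (count-mono c? (¬? ∘ adj? _) (C-independent cx)) (maximal x)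
      ... | no ∄c        = count-mono c? (¬? ∘ adj? _) λ cw → contradiction (_ , cw) ∄c

-- Effect of deleting a vertex on components and arcs.

_∖_ : ∀ {n} → OrientedGraph (Fin (suc n)) → Fin (suc n) → OrientedGraph (Fin n)
D ∖ v = record
  { _⟶_  = _⟶_ on punchIn v
  ; _⟶?_ = λ x y → punchIn v x ⟶? punchIn v y
  ; asym = asym
  }
  where open OrientedGraph D

module _ {n : ℕ} (D : OrientedGraph (Fin (suc n))) (v : Fin (suc n)) where
  open OrientedGraph D using (_⟶_; _⟶?_; asym)

  ∖-triangle : HasDirectedTriangle (D ∖ v) → HasDirectedTriangle D
  ∖-triangle (x , y , z , t) = punchIn v x , punchIn v y , punchIn v z , t

  module _ (u : Fin n) where
    private
      u′ = punchIn v u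
      V  = ∃ (_∈ N⁺ D u′)
      V∖ = ∃ (_∈ N⁺ (D ∖ v) u)
      module Q = HasClasses (components-N⁺ (D ∖ v) u)

      _≈_ : Rel V 0ℓ
      _≈_ = Connected (D [ N⁺ D u′ ])

      embed : V∖ → V
      embed (w , p) = punchIn v w , ⟶⇒∈N⁺ D (∈N⁺⇒⟶ (D ∖ v) p)

      restrict : (x : V) → proj₁ x ≡ v ⊎ ∃ λ y → embed y ≡ x
      restrict (w , p) with v ≟ w
      ... | yes v≡w = inj₁ (sym v≡w)
      ... | no  v≢w = inj₂
        ( (punchOut v≢w , ⟶⇒∈N⁺ (D ∖ v) (subst (u′ ⟶_) (sym eq) (∈N⁺⇒⟶ D p)))
        , vertex-≡ eq)
        where eq = punchIn-punchOut v≢w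

      class⇒≈ : ∀ {x y} → Q.class x ≡ Q.class y → embed x ≈ embed y
      -- An arc after the deletion is by definition an arc of `D` between the embedded ends, hence
      -- `id`.
      class⇒≈ eq = EqC.gmap embed id (Equivalence.to Q.same⇔≈ eq)

      -- If v is not isolated in D[N⁺(u′)], it can be replaced by a neighbour.
      restrict≈ : ¬ IsolatedIn D u′ v → (x : V) → ∃ λ y → embed y ≈ x
      restrict≈ ¬iso x@(_ , p) with restrict x
      ... | inj₂ (y , refl) = y , EqC.reflexive _
      ... | inj₁ refl
        with decidable-stable (linked? D u′ v) (¬iso ∘ (∈N⁺⇒⟶ D p ,_))
      ... | w , u′⟶w , v~w with restrict (w , ⟶⇒∈N⁺ D u′⟶w)
      ... | inj₁ refl     = contradiction v~w (Adj-irrefl D)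
      ... | inj₂ (y , eq) = y , Adj⇒Connected D (swap (subst (Adj D v) (sym (cong proj₁ eq)) v~w))

    -- Deleting `v` never joins two components. If `v` is not isolated, every component keeps a
    -- vertex, because `v` can be traded for a neighbour; in any case one extra class for `v`
    -- suffices.
    ω⁺-∖ : ω⁺ D (punchIn v u) ≤ ⟦ isolatedIn? D (punchIn v u) v ⟧ + ω⁺ (D ∖ v) u
    ω⁺-∖ = ≤⟦⟧+ (isolatedIn? D u′ v)
      (λ ¬iso → classes≤ (components-N⁺ D u′) (Q.class ∘ proj₁ ∘ restrict≈ ¬iso)
        λ {x} {y} eq → EqC.transitive _ (EqC.symmetric _ (proj₂ (restrict≈ ¬iso x)))
          (EqC.transitive _ (class⇒≈ eq) (proj₂ (restrict≈ ¬iso y))))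
      (classes≤ (components-N⁺ D u′) c c⇒≈)
      where
      c : V → Fin (suc (ω⁺ (D ∖ v) u))
      -- The value `zero` is reserved for `v`; other vertices keep their new component, shifted by
      -- one.
      c x = [ const zero , suc ∘ Q.class ∘ proj₁ ] (restrict x)

      c⇒≈ : ∀ {x y} → c x ≡ c y → x ≈ y
      c⇒≈ {x} {y} eq with restrict x | restrict y
      ... | inj₁ p          | inj₁ q          with refl ← vertex-≡ {x = x} {y} (trans p (sym q))
        = EqC.reflexive _
      ... | inj₂ (_ , refl) | inj₂ (_ , refl) = class⇒≈ (suc-injective eq)

  ∑ω⁺-∖ : ∑[ u < suc n ] ω⁺ D u ≤
          ω⁺ D v + count (λ u → isolatedIn? D u v) + ∑[ u < n ] ω⁺ (D ∖ v) u
  ∑ω⁺-∖ = begin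
    ∑[ u < suc n ] ω⁺ D u                             ≡⟨ sum-remove {i = v} (ω⁺ D) ⟩
    ω⁺ D v + ∑[ u < n ] ω⁺ D (punchIn v u)            ≤⟨ +-monoʳ-≤ (ω⁺ D v) (sum-mono ω⁺-∖) ⟩
    ω⁺ D v + ∑[ u < n ] (iso (punchIn v u) + ω⁺ (D ∖ v) u)
      ≡⟨ cong (ω⁺ D v +_) (∑-distrib-+ (iso ∘ punchIn v) (ω⁺ (D ∖ v))) ⟩
    ω⁺ D v + (sum (iso ∘ punchIn v) + ∑[ u < n ] ω⁺ (D ∖ v) u)
      -- The term at `v` itself is put back so that the sum becomes a count over all vertices.
      ≤⟨ +-monoʳ-≤ (ω⁺ D v) (+-monoˡ-≤ _ (sum-punchIn-≤ v iso)) ⟩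
    ω⁺ D v + (sum iso + ∑[ u < n ] ω⁺ (D ∖ v) u)      ≡⟨ +-assoc (ω⁺ D v) (sum iso) _ ⟨
    ω⁺ D v + sum iso + ∑[ u < n ] ω⁺ (D ∖ v) u        ∎
    where
    open ≤-Reasoning
    iso = λ u → ⟦ isolatedIn? D u v ⟧

  -- In the adjacency matrix, row `v` holds the arcs out of `v`, column `v` those into it, and the
  -- rest belongs to the smaller graph. By asymmetry row and column count disjoint sets of
  -- neighbours.
  a-∖ : a D ≤ count (adj? D v) + a (D ∖ v)
  a-∖ = begin
    a D                                                ≡⟨ a≡ D ⟩
    ∑[ u < suc n ] count (u ⟶?_)                       ≡⟨ sum-remove {i = v} (λ u → count (u ⟶?_)) ⟩
    count (v ⟶?_) + ∑[ u < n ] count (punchIn v u ⟶?_)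
      ≡⟨ cong (count (v ⟶?_) +_) (sum-cong-≗ λ u → sum-remove {i = v} (λ w → ⟦ punchIn v u ⟶? w ⟧)) ⟩
    count (v ⟶?_) + ∑[ u < n ] (into (punchIn v u) + row u)
      ≡⟨ cong (count (v ⟶?_) +_) (∑-distrib-+ (into ∘ punchIn v) row) ⟩
    count (v ⟶?_) + (sum (into ∘ punchIn v) + sum row)
      ≤⟨ +-monoʳ-≤ (count (v ⟶?_)) (+-monoˡ-≤ _ (sum-punchIn-≤ v into)) ⟩
    count (v ⟶?_) + (sum into + sum row)               ≡⟨ +-assoc (count (v ⟶?_)) (sum into) _ ⟨
    count (v ⟶?_) + count (_⟶? v) + sum row
      ≤⟨ +-monoˡ-≤ _ (count-⊎ (v ⟶?_) (_⟶? v) (λ (l , m) → asym l m)) ⟩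
    count (adj? D v) + sum row                         ≡⟨ cong (count (adj? D v) +_) (a≡ (D ∖ v)) ⟨
    count (adj? D v) + a (D ∖ v)                       ∎
    where
    open ≤-Reasoning
    into = λ u → ⟦ u ⟶? v ⟧
    row  = λ (u : Fin n) → count (λ w → punchIn v u ⟶? punchIn v w)

  a+∑ω⁺-∖ : ¬ HasDirectedTriangle D → (∀ x → nonAdj# D x ≤ nonAdj# D v) →
            a D + ∑[ u < suc n ] ω⁺ D u ≤ a (D ∖ v) + ∑[ u < n ] ω⁺ (D ∖ v) u + suc n
  a+∑ω⁺-∖ ¬△ maximal = begin
    a D + sum (ω⁺ D)                          ≤⟨ +-mono-≤ a-∖ ∑ω⁺-∖ ⟩
    (deg + a (D ∖ v)) + (ω⁺ D v + isolations + sum (ω⁺ (D ∖ v)))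
      ≤⟨ +-monoʳ-≤ (deg + a (D ∖ v)) (+-monoˡ-≤ _ (ω⁺+isolations≤nonAdj# D ¬△ v maximal)) ⟩
    (deg + a (D ∖ v)) + (nonAdj# D v + sum (ω⁺ (D ∖ v)))
      ≡⟨ rearrange deg (a (D ∖ v)) (nonAdj# D v) _ ⟩
    a (D ∖ v) + sum (ω⁺ (D ∖ v)) + (deg + nonAdj# D v)
      -- Neighbours and non-neighbours of `v`, with `v` among the latter, make up all `suc n`
      -- vertices.
      ≡⟨ cong (a (D ∖ v) + sum (ω⁺ (D ∖ v)) +_) (count-¬ (adj? D v)) ⟩
    a (D ∖ v) + sum (ω⁺ (D ∖ v)) + suc n      ∎
    where
    open ≤-Reasoning
    deg = count (adj? D v)
    isolations = count (λ u → isolatedIn? D u v)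
    rearrange : ∀ x y z w → (x + y) + (z + w) ≡ y + w + (x + z)
    rearrange = solve-∀

-- Induction on the number of vertices.

∃-maximum : ∀ {n} (f : Fin (suc n) → ℕ) → ∃ λ v → ∀ x → f x ≤ f v
∃-maximum {n} f = argmax f zero (allFin (suc n)) , λ x →
  All.lookup (f[xs]≤f[argmax] {f = f} zero (allFin (suc n))) (∈-allFin x)

triangular-suc : ∀ n → suc n * (suc n + 1) / 2 ≡ n * (n + 1) / 2 + suc n
triangular-suc n = begin
  suc n * (suc n + 1) / 2             ≡⟨ cong (_/ 2) (expand n) ⟩
  -- The increment is even, so it splits off from the truncated division exactly.
  (n * (n + 1) + suc n * 2) / 2       ≡⟨ +-distrib-/-∣ʳ (n * (n + 1)) (n∣m*n (suc n)) ⟩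
  n * (n + 1) / 2 + suc n * 2 / 2     ≡⟨ cong (n * (n + 1) / 2 +_) (m*n/n≡m (suc n) 2) ⟩
  n * (n + 1) / 2 + suc n             ∎
  where
  open ≡-Reasoning
  expand : ∀ n → suc n * (suc n + 1) ≡ n * (n + 1) + suc n * 2
  expand = solve-∀

a+∑ω⁺-single : (D : OrientedGraph (Fin 1)) → a D + ∑[ v < 1 ] ω⁺ D v ≤ 0
a+∑ω⁺-single D = +-mono-≤ a≤0 (+-mono-≤ ω⁺≤0 z≤n)
  where
  open OrientedGraph D using (_⟶?_)
  no-loop = Adj-irrefl D {zero} ∘ inj₁

  a≤0 : a D ≤ 0
  a≤0 = ≤-reflexive (trans (a≡ D) (cong (λ k → k + 0 + 0) (⟦⟧-no (zero ⟶? zero) no-loop)))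

  ω⁺≤0 : ω⁺ D zero ≤ 0
  ω⁺≤0 = classes≤ (components-N⁺ D zero)
    (λ { (zero , p) → contradiction (∈N⁺⇒⟶ D p) no-loop })
    λ { {zero , p} → contradiction (∈N⁺⇒⟶ D p) no-loop }

-- Strictness comes from the single vertex, where the claim is `0 < 1`; each further vertex raises
-- the right side by exactly the largest possible drop. With no vertices both sides would be `0`,
-- hence the start at `suc n`.
a+∑ω⁺-bound : ∀ n (D : OrientedGraph (Fin (suc n))) → ¬ HasDirectedTriangle D →
              a D + ∑[ v < suc n ] ω⁺ D v < suc n * (suc n + 1) / 2
a+∑ω⁺-bound zero    D _  = s≤s (a+∑ω⁺-single D)
a+∑ω⁺-bound (suc n) D ¬△ = begin-strict
  a D + sum (ω⁺ D)                                ≤⟨ a+∑ω⁺-∖ D v ¬△ (proj₂ (∃-maximum (nonAdj# D))) ⟩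
  a (D ∖ v) + sum (ω⁺ (D ∖ v)) + suc (suc n)
    <⟨ +-monoˡ-≤ (suc (suc n)) (a+∑ω⁺-bound n (D ∖ v) (¬△ ∘ ∖-triangle D v)) ⟩
  suc n * (suc n + 1) / 2 + suc (suc n)           ≡⟨ triangular-suc (suc n) ⟨
  suc (suc n) * (suc (suc n) + 1) / 2             ∎
  where
  open ≤-Reasoning
  v = proj₁ (∃-maximum (nonAdj# D))

theorem4 : ∀ (n : ℕ) .{{_ : NonZero n}} (D : OrientedGraph (Fin n)) →
    a D + ∑[ v < n ] ω⁺ D v ≥ n * (n + 1) / 2 → HasDirectedTriangle D
theorem4 (suc n) D large = decidable-stable (hasDirectedTriangle? D) λ ¬△ →
  <⇒≱ (a+∑ω⁺-bound n D ¬△) large
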